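{- Let $X$ be a finite group with $|X|=n$ and let $S\subseteq X$ be a generating set with $|S|=d$ and $S^{ -1}=S$. Let $G$ be the Cayley graph $(X,S)$, and suppose $G$ is not bipartite. Then $$h_{out}(G)\leq 200\,\beta_{out}(G).$$
   Context: The Cayley graph $(X,S)$ has vertex set $X$ and edges $g\sim gs$ for all $g\in X$, $s\in S$. For a vertex set $A$, $\partial_{out}(A)$ is the set of vertices not in $A$ having a neighbor in $A$, and $I(A)$ is the number of vertices of $A$ having a neighbor in $A$. The vertex expansion is $h_{out}(G)=\min\{|\partial_{out}(A)|/|A| : A\subseteq X,\ 0<|A|\le n/2\}$. For disjoint $L,R\subseteq X$ with $L\cup R\ne\emptyset$, $b_{out}(L,R)=\dfrac{I(L)+I(R)+|\partial_{out}(L\cup R)|}{|L\cup R|}$, and $\beta_{out}(G)=\min_{L,R}b_{out}(L,R)$ over all such pairs. -}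

module Defs where

open import Algebra.Bundles using (Group)
open import Data.Bool.Base using (Bool)
open import Data.Empty using (⊥-elim)
open import Data.Fin.Base using (Fin; zero)
open import Data.Fin.Properties using (any?; _≟_)
open import Data.Fin.Subset using (Subset; inside; outside; _∈_; _∪_; _∩_; ∣_∣; Nonempty; Empty; ⁅_⁆; ⊤; ⊥)
open import Data.Fin.Subset.Properties using (_∈?_; nonempty?; ∣⁅x⁆∣≡1; ∈⊤; p⊆p∪q; p∩q⊆q; ∉⊥; p⊆q⇒∣p∣≤∣q∣; x∈⁅y⁆⇒x≡y)
open import Data.Integer.Base using (+_)
open import Data.Nat.Base using (ℕ; suc; _+_; _*_; _≤_; _<_; >-nonZero; z≤n; s≤s)
import Data.Nat.Properties as ℕ
open import Data.Product.Base using (∃; ∃-syntax; Σ-syntax; _×_; _,_; proj₁; proj₂)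
open import Data.Rational.Base using (ℚ; _/_) renaming (_≤_ to _≤ℚ_)
import Data.Rational.Properties as ℚ
open import Data.Sum.Base using (_⊎_; inj₁; inj₂)
open import Data.Unit.Base using (tt) renaming (⊤ to Unit)
open import Data.Vec.Base using ([]; _∷_; tabulate)
open import Data.Vec.Properties using (lookup∘tabulate; lookup⇒[]=; []=⇒lookup)
open import Function.Bundles using (Inverse)
open import Level using (Level; _⊔_; 0ℓ)
open import Relation.Binary.Core using (Rel)
import Relation.Binary.Definitions as B
open import Relation.Binary.PropositionalEquality
  using (_≡_; _≢_; refl; sym; trans; subst; setoid)
import Relation.Binary.Reasoning.Setoid as SetoidReasoning
open import Relation.Nullary.Decidable using (yes; no; does; dec-true; _×-dec_; ¬?)
open import Relation.Nullary.Negation using (¬_)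
open import Relation.Unary using (Pred; Decidable)

private
  variable
    c ℓ p : Level
    n : ℕ

comprehension : {P : Pred (Fin n) p} → Decidable P → Subset n
comprehension P? = tabulate (λ x → does (P? x))

∈-comprehension⁺ : {P : Pred (Fin n) p} (P? : Decidable P) →
                   ∀ {x} → P x → x ∈ comprehension P?
∈-comprehension⁺ P? {x} px =
  lookup⇒[]= x _ (trans (lookup∘tabulate _ x) (dec-true (P? x) px))

∈-comprehension⁻ : {P : Pred (Fin n) p} (P? : Decidable P) →
                   ∀ {x} → x ∈ comprehension P? → P x
∈-comprehension⁻ P? {x} x∈ with P? x | trans (sym (lookup∘tabulate (λ y → does (P? y)) x)) ([]=⇒lookup x∈)
... | yes px | _ = px
... | no _   | ()

nonempty⇒0<∣∣ : {A : Subset n} → Nonempty A → 0 < ∣ A ∣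
nonempty⇒0<∣∣ {A = A} (x , x∈A) =
  subst (_≤ ∣ A ∣) (∣⁅x⁆∣≡1 x)
    (p⊆q⇒∣p∣≤∣q∣ (λ y∈ → subst (_∈ A) (sym (x∈⁅y⁆⇒x≡y x y∈)) x∈A))

perVertex : ℕ → (A : Subset n) → .(0 < ∣ A ∣) → ℚ
perVertex k A 0<∣A∣ = _/_ (+ k) ∣ A ∣ {{>-nonZero 0<∣A∣}}

-- Finite graphs, with loops allowed: a vertex with a loop is its own
-- neighbour.

record Graph (n : ℕ) : Set₁ where
  infix 4 _~_ _~?_
  field
    _~_   : Rel (Fin n) 0ℓ
    ~-sym : B.Symmetric _~_
    _~?_  : B.Decidable _~_

module _ (G : Graph n) where
  open Graph G

  HasNeighbourIn : Subset n → Pred (Fin n) 0ℓ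
  HasNeighbourIn A x = ∃[ y ] y ∈ A × x ~ y

  hasNeighbourIn? : ∀ A → Decidable (HasNeighbourIn A)
  hasNeighbourIn? A x = any? (λ y → (y ∈? A) ×-dec (x ~? y))

  ∂out : Subset n → Subset n
  ∂out A = comprehension (λ x → ¬? (x ∈? A) ×-dec hasNeighbourIn? A x)

  I : Subset n → ℕ
  I A = ∣ comprehension (λ x → (x ∈? A) ×-dec hasNeighbourIn? A x) ∣

  Bipartite : Set
  Bipartite = Σ[ colour ∈ (Fin n → Bool) ] (∀ {x y} → x ~ y → colour x ≢ colour y)

  bout : (L R : Subset n) → .(Nonempty (L ∪ R)) → ℚ
  bout L R L∪R≢∅ =
    perVertex (I L + I R + ∣ ∂out (L ∪ R) ∣) (L ∪ R) (nonempty⇒0<∣∣ L∪R≢∅)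

  -- The sets of numbers whose minima are h_out and β_out.

  data ExpansionRatio : Pred ℚ 0ℓ where
    expansionRatio : (A : Subset n) (0<∣A∣ : 0 < ∣ A ∣) → 2 * ∣ A ∣ ≤ n →
                     ExpansionRatio (perVertex ∣ ∂out A ∣ A 0<∣A∣)

  data BipartitenessRatio : Pred ℚ 0ℓ where
    bipartitenessRatio : (L R : Subset n) → Empty (L ∩ R) →
                         (L∪R≢∅ : Nonempty (L ∪ R)) →
                         BipartitenessRatio (bout L R L∪R≢∅)

IsMinimum : Pred ℚ p → Pred ℚ p
IsMinimum V q = V q × (∀ {r} → V r → q ≤ℚ r)

-- "h is h_out(G)" and "β is β_out(G)".  The minimum is a relation because
-- h_out ranges over an empty family when n ≤ 1; existence for n ≥ 2
-- (resp. n ≥ 1) is proved at the end of this module.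

IsVertexExpansion : Graph n → Pred ℚ 0ℓ
IsVertexExpansion G = IsMinimum (ExpansionRatio G)

IsBipartitenessConstant : Graph n → Pred ℚ 0ℓ
IsBipartitenessConstant G = IsMinimum (BipartitenessRatio G)

-- Cayley graphs of a group X with |X| = n.  The enumeration identifies
-- (X, ≈) with Fin n, so subsets of X are represented by Subset n.

module Cayley (X : Group c ℓ)
              (enumeration : Inverse (Group.setoid X) (setoid (Fin n))) where
  open Group X using (Carrier; _≈_; _∙_; ε; _⁻¹; ∙-cong; ∙-congˡ; assoc; identityʳ)
  private module X = Group X
  open Inverse enumeration using (to; from; to-cong; strictlyInverseˡ; strictlyInverseʳ)

  data ⟨_⟩ (S : Subset n) : Pred Carrier (c ⊔ ℓ) where
    generator : ∀ {s} → s ∈ S → ⟨ S ⟩ (from s)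
    identity  : ⟨ S ⟩ ε
    product   : ∀ {x y} → ⟨ S ⟩ x → ⟨ S ⟩ y → ⟨ S ⟩ (x ∙ y)
    inverse   : ∀ {x} → ⟨ S ⟩ x → ⟨ S ⟩ (x ⁻¹)
    respects  : ∀ {x y} → x ≈ y → ⟨ S ⟩ x → ⟨ S ⟩ y

  Generates : Subset n → Set (c ⊔ ℓ)
  Generates S = ∀ x → ⟨ S ⟩ x

  inInverse? : (S : Subset n) →
               Decidable (λ x → ∃[ s ] s ∈ S × to (from s ⁻¹) ≡ x)
  inInverse? S x = any? (λ s → (s ∈? S) ×-dec (to (from s ⁻¹) ≟ x))

  infix 8 _⁻¹ˢ
  _⁻¹ˢ : Subset n → Subset n
  S ⁻¹ˢ = comprehension (inInverse? S)

  cayleyGraph : (S : Subset n) → S ⁻¹ˢ ≡ S → Graph n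
  cayleyGraph S S⁻¹≡S = record
    { _~_   = _~_
    ; ~-sym = ~-sym
    ; _~?_  = λ g h → any? (λ s → (s ∈? S) ×-dec (to (from g ∙ from s) ≟ h))
    }
    where
    _~_ : Rel (Fin n) 0ℓ
    g ~ h = ∃[ s ] s ∈ S × to (from g ∙ from s) ≡ h

    ~-sym : B.Symmetric _~_
    ~-sym {g} (s , s∈S , refl) = s⁻¹ , s⁻¹∈S , trans (to-cong eq) (strictlyInverseˡ g)
      where
      s⁻¹ : Fin n
      s⁻¹ = to (from s ⁻¹)

      s⁻¹∈S : s⁻¹ ∈ S
      s⁻¹∈S = subst (s⁻¹ ∈_) S⁻¹≡S (∈-comprehension⁺ (inInverse? S) (s , s∈S , refl))

      open SetoidReasoning X.setoid

      eq : from (to (from g ∙ from s)) ∙ from s⁻¹ ≈ from g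
      eq = begin
        from (to (from g ∙ from s)) ∙ from s⁻¹  ≈⟨ ∙-cong (strictlyInverseʳ _) (strictlyInverseʳ _) ⟩
        (from g ∙ from s) ∙ from s ⁻¹           ≈⟨ assoc _ _ _ ⟩
        from g ∙ (from s ∙ from s ⁻¹)           ≈⟨ ∙-congˡ (X.inverseʳ _) ⟩
        from g ∙ ε                              ≈⟨ identityʳ _ ⟩
        from g                                  ∎

private
  -- Every rational function on a decidable subset of A attains its
  -- minimum, unless that subset is empty.
  AttainsMinima : Set → Set₁
  AttainsMinima A = {P : Pred A 0ℓ} → Decidable P → (f : ∀ a → .(P a) → ℚ) →
    (∀ a → ¬ P a) ⊎ (∃[ a ] Σ[ pa ∈ P a ] ∀ b (pb : P b) → f a pa ≤ℚ f b pb)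

  Unit-attainsMinima : AttainsMinima Unit
  Unit-attainsMinima P? f with P? tt
  ... | no ¬p = inj₁ λ _ → ¬p
  ... | yes p = inj₂ (tt , p , λ _ _ → ℚ.≤-refl)

  Subset×-attainsMinima : ∀ n {B} → AttainsMinima B → AttainsMinima (Subset n × B)
  Subset×-attainsMinima 0 attains P? f
    with attains (λ b → P? ([] , b)) (λ b → f ([] , b))
  ... | inj₁ none = inj₁ λ { ([] , b) → none b }
  ... | inj₂ (a , p , min) = inj₂ (([] , a) , p , λ { ([] , b) → min b })
  Subset×-attainsMinima (suc n) attains P? f
    with Subset×-attainsMinima n attains
           (λ (A , b) → P? (inside ∷ A , b)) (λ (A , b) → f (inside ∷ A , b))
       | Subset×-attainsMinima n attains
           (λ (A , b) → P? (outside ∷ A , b)) (λ (A , b) → f (outside ∷ A , b))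
  ... | inj₁ ¬i | inj₁ ¬o = inj₁ λ
    { (inside ∷ A , b) → ¬i (A , b) ; (outside ∷ A , b) → ¬o (A , b) }
  ... | inj₂ (_ , p , min) | inj₁ ¬o = inj₂ (_ , p , λ
    { (inside ∷ A , b) → min (A , b) ; (outside ∷ A , b) q → ⊥-elim (¬o (A , b) q) })
  ... | inj₁ ¬i | inj₂ (_ , p , min) = inj₂ (_ , p , λ
    { (inside ∷ A , b) q → ⊥-elim (¬i (A , b) q) ; (outside ∷ A , b) → min (A , b) })
  ... | inj₂ (a , p , min) | inj₂ (a′ , p′ , min′) with ℚ.≤-total (f _ p) (f _ p′)
  ...   | inj₁ le = inj₂ (_ , p , λ
    { (inside ∷ A , b) → min (A , b) ; (outside ∷ A , b) q → ℚ.≤-trans le (min′ (A , b) q) })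
  ...   | inj₂ ge = inj₂ (_ , p′ , λ
    { (inside ∷ A , b) q → ℚ.≤-trans ge (min (A , b) q) ; (outside ∷ A , b) → min′ (A , b) })

  minimum-exists : {A : Set} → AttainsMinima A →
    {V : Pred ℚ 0ℓ} {P : Pred A 0ℓ} (P? : Decidable P) (f : ∀ a → .(P a) → ℚ) →
    (∀ a (pa : P a) → V (f a pa)) →
    (∀ {r} → V r → ∃[ a ] Σ[ pa ∈ P a ] f a pa ≡ r) →
    ∃ P → ∃ (IsMinimum V)
  minimum-exists attains P? f into onto (a₀ , p₀) with attains P? f
  ... | inj₁ none = ⊥-elim (none a₀ p₀)
  ... | inj₂ (a , pa , min) = f a pa , into a pa , λ v →
    let b , pb , eq = onto v in subst (f a pa ≤ℚ_) eq (min b pb)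

vertexExpansion-exists : (G : Graph n) → 2 ≤ n → ∃ (IsVertexExpansion G)
vertexExpansion-exists {n = n@(suc _)} G 2≤n =
  minimum-exists (Subset×-attainsMinima n Unit-attainsMinima)
    (λ (A , _) → (0 ℕ.<? ∣ A ∣) ×-dec (2 * ∣ A ∣ ℕ.≤? n))
    (λ (A , _) p → perVertex ∣ ∂out G A ∣ A (proj₁ p))
    (λ (A , _) (p , q) → expansionRatio A p q)
    (λ { (expansionRatio A p q) → (A , tt) , (p , q) , refl })
    ((⁅ zero ⁆ , tt) ,
     subst (λ k → 0 < k × 2 * k ≤ n) (sym (∣⁅x⁆∣≡1 {n} zero)) (s≤s z≤n , 2≤n))

bipartitenessConstant-exists : (G : Graph n) → 1 ≤ n → ∃ (IsBipartitenessConstant G)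
bipartitenessConstant-exists {n = n@(suc _)} G _ =
  minimum-exists (Subset×-attainsMinima n (Subset×-attainsMinima n Unit-attainsMinima))
    (λ (L , R , _) → ¬? (nonempty? (L ∩ R)) ×-dec nonempty? (L ∪ R))
    (λ (L , R , _) p → bout G L R (proj₂ p))
    (λ (L , R , _) (d , e) → bipartitenessRatio L R d e)
    (λ { (bipartitenessRatio L R d e) → (L , R , tt) , (d , e) , refl })
    ((⊤ , ⊥ , tt) ,
     (λ (_ , x∈) → ∉⊥ (p∩q⊆q ⊤ ⊥ x∈)) , zero , p⊆p∪q {p = ⊤} ⊥ ∈⊤)

{-# OPTIONS --safe #-}

-- Write h = p / q, let (L , R) attain β, put A = L ∪ R and suppose 200 β < h.
-- Outside a defect set D with |D| ≤ β |A| every edge meeting A stays in A and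
-- changes side, and h ≤ 2 makes D and the complement of A sparse.  For a group
-- element g, the points where the side function and its left translate by g
-- agree, and those where they differ, are two disjoint sets whose boundaries
-- lie in D ∪ g⁻¹D; by expansion the smaller one is sparse.  So the translate
-- is, up to sparse sets, the side function multiplied by a sign χ(g), and χ is
-- a homomorphism, as any three sparse sets miss a common point.  Averaging
-- gives a point x₀ with side(g x₀) = χ(g) side(x₀) for most g, whence
-- y ↦ χ(y x₀⁻¹) is an exact 2-colouring, contradicting non-bipartiteness.

module Submission where

open import Defs
open import Algebra.Bundles using (Group)
open import Algebra.Bundles.Raw using (RawGroup)
import Algebra.Morphism.GroupMonomorphism as GroupMonomorphism
import Algebra.Properties.Group as GroupProperties
open import Algebra.Structures using (IsGroup)
open import Data.Bool.Base using (Bool; true; false; not; _xor_; if_then_else_)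
import Data.Bool.Properties as Bool
open import Data.Fin.Base using (Fin; zero; suc)
open import Data.Fin.Permutation using (Permutation′; permutation; _⟨$⟩ʳ_)
open import Data.Fin.Properties using (any?)
open import Data.Fin.Subset using (Subset; inside; outside; _∈_; _∉_; _⊆_; _∪_; ∁; ∣_∣; ⊥; ⊤)
open import Data.Fin.Subset.Properties
import Data.Integer.Base as ℤ
import Data.Integer.Properties as ℤ
open import Data.Nat.Base using (ℕ; zero; suc; _+_; _*_; _∸_; _≤_; _<_; z≤n; s≤s; z<s; NonZero; >-nonZero; >-nonZero⁻¹; ⌊_/2⌋; ⌈_/2⌉)
open import Data.Nat.Properties
open import Data.Nat.Tactic.RingSolver using (solve-∀)
open import Algebra.Properties.CommutativeMonoid.Sum +-0-commutativeMonoid using (sum; ∑-comm; sum-permute; sum-cong-≗)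
open import Algebra.Properties.Semiring.Sum +-*-semiring using (*-distribˡ-sum)
open import Data.Product.Base using (∃-syntax; Σ-syntax; _×_; _,_; proj₁; proj₂)
open import Data.Rational.Base using (ℚ)
import Data.Rational.Base as ℚ
import Data.Rational.Properties as ℚ
import Data.Rational.Unnormalised.Base as ℚᵘ
import Data.Rational.Unnormalised.Properties as ℚᵘ
open import Data.Sum.Base using (inj₁; inj₂; [_,_]′)
open import Data.Vec.Base using ([]; _∷_; lookup; tabulate)
open import Data.Vec.Properties using (lookup∘tabulate; lookup⇒[]=; []=⇒lookup)
open import Function.Base using (_∘_; _$_)
open import Function.Bundles using (Inverse)
open import Level using (Level)
open import Relation.Binary.PropositionalEquality
open import Relation.Nullary.Decidable using (Dec; yes; no; ¬?; _×-dec_; decidable-stable)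
open import Relation.Nullary.Negation using (¬_; contradiction)

private
  variable
    n : ℕ
    c ℓ : Level

-- Counting in finite sets.

preimage : ∀ {m} → (Fin m → Fin n) → Subset n → Subset m
preimage f A = tabulate (lookup A ∘ f)

∈-preimage⁺ : ∀ {m} (f : Fin m → Fin n) {A x} → f x ∈ A → x ∈ preimage f A
∈-preimage⁺ f {x = x} fx∈A =
  lookup⇒[]= x _ (trans (lookup∘tabulate _ x) ([]=⇒lookup fx∈A))

_ᵀ : (Fin n → Subset n) → Fin n → Subset n
(B ᵀ) x = tabulate (λ g → lookup (B g) x)

∈-ᵀ⁺ : ∀ (B : Fin n → Subset n) {x g} → x ∈ B g → g ∈ (B ᵀ) x
∈-ᵀ⁺ B {x} {g} x∈ =
  lookup⇒[]= g _ (trans (lookup∘tabulate _ g) ([]=⇒lookup x∈))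

indicator : Bool → ℕ
indicator b = if b then 1 else 0

∣p∣≡∑ : (p : Subset n) → ∣ p ∣ ≡ sum (indicator ∘ lookup p)
∣p∣≡∑ []            = refl
∣p∣≡∑ (inside ∷ p)  = cong suc (∣p∣≡∑ p)
∣p∣≡∑ (outside ∷ p) = ∣p∣≡∑ p

∣tabulate∣≡∑ : (f : Fin n → Bool) → ∣ tabulate f ∣ ≡ sum (indicator ∘ f)
∣tabulate∣≡∑ f =
  trans (∣p∣≡∑ (tabulate f)) (sum-cong-≗ (cong indicator ∘ lookup∘tabulate f))

∣preimage∣≡∣p∣ : (π : Permutation′ n) (p : Subset n) → ∣ preimage (π ⟨$⟩ʳ_) p ∣ ≡ ∣ p ∣
∣preimage∣≡∣p∣ π p = begin
  ∣ preimage (π ⟨$⟩ʳ_) p ∣                   ≡⟨ ∣tabulate∣≡∑ (lookup p ∘ (π ⟨$⟩ʳ_)) ⟩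
  sum (indicator ∘ lookup p ∘ (π ⟨$⟩ʳ_))     ≡⟨ sum-permute (indicator ∘ lookup p) π ⟨
  sum (indicator ∘ lookup p)                 ≡⟨ ∣p∣≡∑ p ⟨
  ∣ p ∣                                      ∎
  where open ≡-Reasoning

-- Double counting of the pairs `(g , x)` with `x ∈ B g`.
∑∣ᵀ∣≡∑∣∣ : (B : Fin n → Subset n) → sum (∣_∣ ∘ (B ᵀ)) ≡ sum (∣_∣ ∘ B)
∑∣ᵀ∣≡∑∣∣ B = begin
  sum (λ x → ∣ (B ᵀ) x ∣)                              ≡⟨ sum-cong-≗ (λ x → ∣tabulate∣≡∑ (λ g → lookup (B g) x)) ⟩
  sum (λ x → sum (λ g → indicator (lookup (B g) x)))   ≡⟨ ∑-comm (λ x g → indicator (lookup (B g) x)) ⟩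
  sum (λ g → sum (λ x → indicator (lookup (B g) x)))   ≡⟨ sum-cong-≗ (λ g → sym (∣p∣≡∑ (B g))) ⟩
  sum (λ g → ∣ B g ∣)                                  ∎
  where open ≡-Reasoning

∣p∪q∣≤∣p∣+∣q∣ : (p q : Subset n) → ∣ p ∪ q ∣ ≤ ∣ p ∣ + ∣ q ∣
∣p∪q∣≤∣p∣+∣q∣ []            []            = z≤n
∣p∪q∣≤∣p∣+∣q∣ (outside ∷ p) (outside ∷ q) = ∣p∪q∣≤∣p∣+∣q∣ p q
∣p∪q∣≤∣p∣+∣q∣ (outside ∷ p) (inside ∷ q)  =
  ≤-trans (s≤s (∣p∪q∣≤∣p∣+∣q∣ p q)) (≤-reflexive (sym (+-suc (∣ p ∣) (∣ q ∣))))
∣p∪q∣≤∣p∣+∣q∣ (inside ∷ p)  (y ∷ q)       =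
  s≤s (≤-trans (∣p∪q∣≤∣p∣+∣q∣ p q) (+-monoʳ-≤ ∣ p ∣ (∣p∣≤∣x∷p∣ y q)))

disjoint⇒∣p∣+∣q∣≤n : (p q : Subset n) → (∀ {x} → x ∈ p → x ∉ q) → ∣ p ∣ + ∣ q ∣ ≤ n
disjoint⇒∣p∣+∣q∣≤n {n} p q disj = begin
  ∣ p ∣ + ∣ q ∣         ≤⟨ +-monoʳ-≤ ∣ p ∣ (p⊆q⇒∣p∣≤∣q∣ {q = ∁ p} (λ x∈q → x∉p⇒x∈∁p (λ x∈p → disj x∈p x∈q))) ⟩
  ∣ p ∣ + ∣ ∁ p ∣       ≡⟨ cong (∣ p ∣ +_) (∣∁p∣≡n∸∣p∣ p) ⟩
  ∣ p ∣ + (n ∸ ∣ p ∣)   ≡⟨ m+[n∸m]≡n (∣p∣≤n p) ⟩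
  n                     ∎
  where open ≤-Reasoning

∣p∣<n⇒∃∉ : (p : Subset n) → ∣ p ∣ < n → ∃[ x ] x ∉ p
∣p∣<n⇒∃∉ {n} p ∣p∣<n with any? (λ x → ¬? (x ∈? p))
... | yes x∉p = x∉p
... | no  all = contradiction ∣p∣<n (≤⇒≯ (subst (_≤ ∣ p ∣) (∣⊤∣≡n n)
  (p⊆q⇒∣p∣≤∣q∣ {p = ⊤} {p} (λ {x} _ → decidable-stable (x ∈? p) (λ x∉p → all (x , x∉p))))))

subset-of-size : ∀ {k} → k ≤ n → Σ[ p ∈ Subset n ] ∣ p ∣ ≡ k
subset-of-size {n} z≤n       = ⊥ , ∣⊥∣≡0 n
subset-of-size (s≤s k≤n) =
  let p , ∣p∣≡k = subset-of-size k≤n in inside ∷ p , cong suc ∣p∣≡k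

∑-lower : ∀ t (f : Fin n → ℕ) → (∀ i → t ≤ f i) → n * t ≤ sum f
∑-lower {zero}  t f t≤ = z≤n
∑-lower {suc n} t f t≤ = +-mono-≤ (t≤ zero) (∑-lower t (f ∘ suc) (t≤ ∘ suc))

∑-upper : ∀ t (f : Fin n → ℕ) → (∀ i → f i ≤ t) → sum f ≤ n * t
∑-upper {zero}  t f ≤t = z≤n
∑-upper {suc n} t f ≤t = +-mono-≤ (≤t zero) (∑-upper t (f ∘ suc) (≤t ∘ suc))

-- Sparse sets.

-- 1/25 = (3 + 3 + 2)/200: a point is exceptional for g if x or g x lies outside A
-- (3/200 each) or if x is in the minority set of g (2/200).
record Sparse (p : Subset n) : Set where
  constructor sparse
  field
    bound : 25 * ∣ p ∣ ≤ n

-- Points and indices both range over `Fin n`, so by double counting the family and its transpose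
-- have the same mean size, and some transposed set is no larger than the mean.
average : .{{NonZero n}} → (B : Fin n → Subset n) → (∀ g → Sparse (B g)) → ∃[ x ] Sparse ((B ᵀ) x)
average {n} B B-sparse with any? (λ x → 25 * ∣ (B ᵀ) x ∣ ≤? n)
... | yes (x , bound) = x , sparse bound
... | no  none  = contradiction (*-cancelˡ-≤ n (begin
  n * suc n                          ≤⟨ ∑-lower (suc n) _ (λ x → ≰⇒> (λ le → none (x , le))) ⟩
  sum (λ x → 25 * ∣ (B ᵀ) x ∣)       ≡⟨ *-distribˡ-sum 25 (∣_∣ ∘ (B ᵀ)) ⟨
  25 * sum (∣_∣ ∘ (B ᵀ))             ≡⟨ cong (25 *_) (∑∣ᵀ∣≡∑∣∣ B) ⟩
  25 * sum (∣_∣ ∘ B)                 ≡⟨ *-distribˡ-sum 25 (∣_∣ ∘ B) ⟩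
  sum (λ g → 25 * ∣ B g ∣)           ≤⟨ ∑-upper n _ (Sparse.bound ∘ B-sparse) ⟩
  n * n                              ∎)) 1+n≰n
  where open ≤-Reasoning

sparse-union-avoidable : .{{NonZero n}} → (p q r : Subset n) → Sparse p → Sparse q → Sparse r →
                         ∃[ x ] x ∉ p × x ∉ q × x ∉ r
sparse-union-avoidable {n} p q r (sparse p≤) (sparse q≤) (sparse r≤) =
  let x , x∉ = ∣p∣<n⇒∃∉ (p ∪ (q ∪ r)) (*-cancelˡ-< 25 _ _ (begin-strict
        25 * ∣ p ∪ (q ∪ r) ∣                        ≤⟨ *-monoʳ-≤ 25 (≤-trans (∣p∪q∣≤∣p∣+∣q∣ p _) (+-monoʳ-≤ ∣ p ∣ (∣p∪q∣≤∣p∣+∣q∣ q r))) ⟩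
        25 * (∣ p ∣ + (∣ q ∣ + ∣ r ∣))              ≡⟨ distrib (∣ p ∣) (∣ q ∣) (∣ r ∣) ⟩
        25 * ∣ p ∣ + (25 * ∣ q ∣ + 25 * ∣ r ∣)      ≤⟨ +-mono-≤ p≤ (+-mono-≤ q≤ r≤) ⟩
        n + (n + n)                                 ≡⟨ triple n ⟩
        3 * n                                       <⟨ *-monoˡ-< n {3} {25} (s≤s (s≤s (s≤s (s≤s z≤n)))) ⟩
        25 * n                                      ∎))
  in x , x∉ ∘ x∈p∪q⁺ ∘ inj₁ , x∉ ∘ x∈p∪q⁺ ∘ inj₂ ∘ x∈p∪q⁺ ∘ inj₁ , x∉ ∘ x∈p∪q⁺ ∘ inj₂ ∘ x∈p∪q⁺ ∘ inj₂
  where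
  open ≤-Reasoning
  distrib : ∀ a b c → 25 * (a + (b + c)) ≡ 25 * a + (25 * b + 25 * c)
  distrib = solve-∀
  triple : ∀ a → a + (a + a) ≡ 3 * a
  triple = solve-∀

xor-cancelʳ : ∀ a b c → a xor c ≡ b xor c → a ≡ b
xor-cancelʳ a b c eq = begin
  a              ≡⟨ Bool.xor-identityʳ a ⟨
  a xor false    ≡⟨ cong (a xor_) (Bool.xor-same c) ⟨
  a xor (c xor c) ≡⟨ Bool.xor-assoc a c c ⟨
  (a xor c) xor c ≡⟨ cong (_xor c) eq ⟩
  (b xor c) xor c ≡⟨ Bool.xor-assoc b c c ⟩
  b xor (c xor c) ≡⟨ cong (b xor_) (Bool.xor-same c) ⟩
  b xor false    ≡⟨ Bool.xor-identityʳ b ⟩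
  b              ∎
  where open ≡-Reasoning

∈-∂out⁻ : (G : Graph n) → ∀ B {x} → x ∈ ∂out G B → x ∉ B × HasNeighbourIn G B x
∈-∂out⁻ G B = ∈-comprehension⁻ (λ x → ¬? (x ∈? B) ×-dec hasNeighbourIn? G B x)

-- Left translates of an almost proper 2-colouring.

module Translates
  (G : Graph n)
  {_·_ : Fin n → Fin n → Fin n} {e : Fin n} {inv : Fin n → Fin n}
  (isGroup : IsGroup _≡_ _·_ e inv)
  (translate : ∀ t {x y} → Graph._~_ G x y → Graph._~_ G (t · x) (t · y))
  (A D : Subset n) (c : Fin n → Bool)
  -- Seen from `x ∉ D`, an edge reaching `A` comes from within `A` and changes side.
  (alternates : ∀ {x y} → Graph._~_ G x y → y ∈ A → x ∉ D → x ∈ A × c x ≡ not (c y))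
  -- `p / q` stands for the expansion constant; `D-small` is `200 |D| / |A| < p / q` cleared of
  -- denominators.
  (p q : ℕ) (p≤2q : p ≤ 2 * q)
  (expanding : ∀ B → 0 < ∣ B ∣ → 2 * ∣ B ∣ ≤ n → p * ∣ B ∣ ≤ ∣ ∂out G B ∣ * q)
  (D-small : 200 * (∣ D ∣ * q) < p * ∣ A ∣)
  where

  open Graph G

  private
    group : Group _ _
    group = record { isGroup = isGroup }
    open IsGroup isGroup using (assoc)
    open GroupProperties group using (\\-leftDividesˡ; \\-leftDividesʳ; //-rightDividesˡ; //-rightDividesʳ)

    instance
      pA-nonZero : NonZero (p * ∣ A ∣)
      pA-nonZero = >-nonZero (≤-<-trans z≤n D-small)

      p-nonZero : NonZero p
      p-nonZero = m*n≢0⇒m≢0 p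

      A-nonZero : NonZero ∣ A ∣
      A-nonZero = m*n≢0⇒n≢0 p

      n-nonZero : NonZero n
      n-nonZero = >-nonZero (<-≤-trans (>-nonZero⁻¹ ∣ A ∣) (∣p∣≤n A))

  left right : Fin n → Permutation′ n
  left  g = permutation (g ·_) (inv g ·_) (\\-leftDividesˡ g) (\\-leftDividesʳ g)
  right g = permutation (_· g) (_· inv g) (//-rightDividesˡ g) (//-rightDividesʳ g)

  -- Expansion bounds `p |B|` by `k |D| q`, and `D-small` bounds `200 |D| q` by `p |A|`; then `p`
  -- cancels.
  small-boundary⇒small : ∀ k B → 2 * ∣ B ∣ ≤ n → ∣ ∂out G B ∣ ≤ k * ∣ D ∣ →
                         200 * ∣ B ∣ ≤ k * ∣ A ∣
  small-boundary⇒small k B 2B≤n ∂B≤ with 0 <? ∣ B ∣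
  -- `expanding` does not cover the empty set, where the bound is trivial.
  ... | no  B≯0 = subst (λ b → 200 * b ≤ k * ∣ A ∣) (sym (n≤0⇒n≡0 (≮⇒≥ B≯0))) z≤n
  ... | yes 0<B = *-cancelˡ-≤ p (begin
    p * (200 * ∣ B ∣)              ≡⟨ e₁ p (∣ B ∣) ⟩
    200 * (p * ∣ B ∣)              ≤⟨ *-monoʳ-≤ 200 (expanding B 0<B 2B≤n) ⟩
    200 * (∣ ∂out G B ∣ * q)       ≤⟨ *-monoʳ-≤ 200 (*-monoˡ-≤ q ∂B≤) ⟩
    200 * (k * ∣ D ∣ * q)          ≡⟨ e₂ k (∣ D ∣) q ⟩
    k * (200 * (∣ D ∣ * q))        ≤⟨ *-monoʳ-≤ k (<⇒≤ D-small) ⟩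
    k * (p * ∣ A ∣)                ≡⟨ e₃ k p (∣ A ∣) ⟩
    p * (k * ∣ A ∣)                ∎)
    where
    open ≤-Reasoning
    e₁ : ∀ a b → a * (200 * b) ≡ 200 * (a * b)
    e₁ = solve-∀
    e₂ : ∀ a b c → 200 * (a * b * c) ≡ a * (200 * (b * c))
    e₂ = solve-∀
    e₃ : ∀ a b c → a * (b * c) ≡ b * (a * c)
    e₃ = solve-∀

  -- With `p ≤ 2 q`, `D-small` gives `100 |D| < |A|`.
  D-bound : 200 * ∣ D ∣ ≤ 2 * n
  D-bound = begin
    200 * ∣ D ∣          ≡⟨ e₁ (∣ D ∣) ⟩
    2 * (100 * ∣ D ∣)    ≤⟨ *-monoʳ-≤ 2 (<⇒≤ (*-cancelˡ-< (2 * q) _ _ (begin-strict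
        2 * q * (100 * ∣ D ∣)   ≡⟨ e₂ q (∣ D ∣) ⟩
        200 * (∣ D ∣ * q)       <⟨ D-small ⟩
        p * ∣ A ∣               ≤⟨ *-monoˡ-≤ (∣ A ∣) p≤2q ⟩
        2 * q * ∣ A ∣           ∎))) ⟩
    2 * ∣ A ∣            ≤⟨ *-monoʳ-≤ 2 (∣p∣≤n A) ⟩
    2 * n                ∎
    where
    open ≤-Reasoning
    e₁ : ∀ a → 200 * a ≡ 2 * (100 * a)
    e₁ = solve-∀
    e₂ : ∀ a b → 2 * a * (100 * b) ≡ 200 * (b * a)
    e₂ = solve-∀

  ∂A⊆D : ∂out G A ⊆ D
  ∂A⊆D {x} x∈∂A with ∈-∂out⁻ G A x∈∂A | x ∈? D
  ... | _                   | yes x∈D = x∈D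
  ... | x∉A , y , y∈A , x~y | no  x∉D = contradiction (proj₁ (alternates x~y y∈A x∉D)) x∉A

  -- Otherwise expansion applies to `A` itself, whose boundary lies in `D`, and gives
  -- `200 |A| ≤ |A|`, impossible for nonempty `A`.
  A-large : n < 2 * ∣ A ∣
  A-large = ≰⇒> λ 2A≤n →
    contradiction (≤-trans (*-monoˡ-≤ (∣ A ∣) {2} {200} (s≤s (s≤s z≤n)))
      (small-boundary⇒small 1 A 2A≤n (≤-trans (p⊆q⇒∣p∣≤∣q∣ ∂A⊆D) (≤-reflexive (sym (*-identityˡ _))))))
      (<⇒≱ (*-monoˡ-< (∣ A ∣) {1} {2} (s≤s (s≤s z≤n))))

  far : Subset n
  far = ∁ (A ∪ D)

  -- An edge from `A` to `far` would end outside `D`, so `alternates` would put that end in `A`.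
  ∂far⊆D : ∂out G far ⊆ D
  ∂far⊆D {x} x∈∂ with ∈-∂out⁻ G far x∈∂
  ... | x∉far , y , y∈far , x~y with x∈p∪q⁻ A D (x∉∁p⇒x∈p x∉far)
  ...   | inj₂ x∈D = x∈D
  ...   | inj₁ x∈A = contradiction
    (x∈p∪q⁺ (inj₁ (proj₁ (alternates (~-sym x~y) x∈A (x∈∁p⇒x∉p y∈far ∘ x∈p∪q⁺ ∘ inj₂)))))
    (x∈∁p⇒x∉p y∈far)

  ∁A-bound : 200 * ∣ ∁ A ∣ ≤ 3 * n
  ∁A-bound = begin
    200 * ∣ ∁ A ∣                  ≤⟨ *-monoʳ-≤ 200 (≤-trans (p⊆q⇒∣p∣≤∣q∣ ∁A⊆) (∣p∪q∣≤∣p∣+∣q∣ far D)) ⟩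
    200 * (∣ far ∣ + ∣ D ∣)        ≡⟨ *-distribˡ-+ 200 (∣ far ∣) (∣ D ∣) ⟩
    200 * ∣ far ∣ + 200 * ∣ D ∣    ≤⟨ +-mono-≤ (small-boundary⇒small 1 far 2far≤n ∂far≤) D-bound ⟩
    1 * ∣ A ∣ + 2 * n              ≤⟨ +-monoˡ-≤ (2 * n) (*-monoʳ-≤ 1 (∣p∣≤n A)) ⟩
    1 * n + 2 * n                  ≡⟨ *-distribʳ-+ n 1 2 ⟨
    3 * n                          ∎
    where
    open ≤-Reasoning
    ∁A⊆ : ∁ A ⊆ far ∪ D
    ∁A⊆ {x} x∈∁A with x ∈? D
    ... | yes x∈D = x∈p∪q⁺ (inj₂ x∈D)
    ... | no  x∉D = x∈p∪q⁺ (inj₁ (x∉p⇒x∈∁p ([ x∈∁p⇒x∉p x∈∁A , x∉D ]′ ∘ x∈p∪q⁻ A D)))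
    ∂far≤ : ∣ ∂out G far ∣ ≤ 1 * ∣ D ∣
    ∂far≤ = ≤-trans (p⊆q⇒∣p∣≤∣q∣ ∂far⊆D) (≤-reflexive (sym (*-identityˡ _)))
    A+far≤n : ∣ A ∣ + ∣ far ∣ ≤ n
    A+far≤n = disjoint⇒∣p∣+∣q∣≤n A far λ x∈A x∈far → x∈∁p⇒x∉p x∈far (x∈p∪q⁺ (inj₁ x∈A))
    -- `far` misses `A`, which fills more than half of the graph, so expansion applies to `far`.
    2far≤n : 2 * ∣ far ∣ ≤ n
    2far≤n = <⇒≤ (+-cancelˡ-< (2 * ∣ A ∣) _ _ (begin-strict
      2 * ∣ A ∣ + 2 * ∣ far ∣   ≡⟨ *-distribˡ-+ 2 (∣ A ∣) (∣ far ∣) ⟨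
      2 * (∣ A ∣ + ∣ far ∣)     ≤⟨ *-monoʳ-≤ 2 A+far≤n ⟩
      2 * n                     ≡⟨ cong (n +_) (+-identityʳ n) ⟩
      n + n                     <⟨ +-monoˡ-< n A-large ⟩
      2 * ∣ A ∣ + n             ∎))

  -- The sign `b` tells whether translation by `g` keeps (`false`) or flips (`true`) the side of
  -- `x`.
  Agreement : Fin n → Bool → Fin n → Set
  Agreement g b x = x ∈ A × (g · x) ∈ A × c (g · x) ≡ b xor c x

  agreement? : ∀ g b x → Dec (Agreement g b x)
  agreement? g b x = (x ∈? A) ×-dec ((g · x) ∈? A) ×-dec (c (g · x) Bool.≟ b xor c x)

  agreement : Fin n → Bool → Subset n
  agreement g b = comprehension (agreement? g b)

  -- Along an edge from `y` to `x` with `x` and `g · x` outside `D`, both `c x` and `c (g · x)`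
  -- flip, so agreement passes from `y` to `x`. A boundary point therefore has `x ∈ D` or
  -- `g · x ∈ D`.
  ∂agreement-bound : ∀ g b → ∣ ∂out G (agreement g b) ∣ ≤ 2 * ∣ D ∣
  ∂agreement-bound g b = begin
    ∣ ∂out G (agreement g b) ∣        ≤⟨ p⊆q⇒∣p∣≤∣q∣ ∂⊆ ⟩
    ∣ D ∪ preimage (g ·_) D ∣         ≤⟨ ∣p∪q∣≤∣p∣+∣q∣ D _ ⟩
    ∣ D ∣ + ∣ preimage (g ·_) D ∣     ≡⟨ cong (∣ D ∣ +_) (∣preimage∣≡∣p∣ (left g) D) ⟩
    ∣ D ∣ + ∣ D ∣                     ≡⟨ cong (∣ D ∣ +_) (+-identityʳ _) ⟨
    2 * ∣ D ∣                         ∎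
    where
    open ≤-Reasoning
    ∂⊆ : ∂out G (agreement g b) ⊆ D ∪ preimage (g ·_) D
    ∂⊆ {x} x∈∂ with x ∈? D | (g · x) ∈? D | ∈-∂out⁻ G (agreement g b) x∈∂
    ... | yes x∈D | _         | _ = x∈p∪q⁺ (inj₁ x∈D)
    ... | no _    | yes gx∈D  | _ = x∈p∪q⁺ (inj₂ (∈-preimage⁺ (g ·_) gx∈D))
    ... | no x∉D  | no gx∉D   | x∉ , y , y∈ , x~y =
      let y∈A , gy∈A , cgy = ∈-comprehension⁻ (agreement? g b) y∈
          x∈A , cx         = alternates x~y y∈A x∉D
          gx∈A , cgx       = alternates (translate g x~y) gy∈A gx∉D
          eq : c (g · x) ≡ b xor c x
          eq = trans cgx (trans (cong not cgy)
                 (trans (Bool.not-distribʳ-xor b (c y)) (cong (b xor_) (sym cx))))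
      in contradiction (∈-comprehension⁺ (agreement? g b) (x∈A , gx∈A , eq)) x∉

  -- The sets of the two signs are disjoint, so at most one exceeds half; its sign is chosen, and
  -- `false` when neither does.
  majority : ∀ g → ∃[ b ] 2 * ∣ agreement g (not b) ∣ ≤ n
  majority g with n <? 2 * ∣ agreement g true ∣
  ... | no  n≮ = false , ≮⇒≥ n≮
  ... | yes n< = true , <⇒≤ (+-cancelˡ-< (2 * ∣ agreement g true ∣) _ _ (begin-strict
    2 * ∣ agreement g true ∣ + 2 * ∣ agreement g false ∣  ≡⟨ *-distribˡ-+ 2 (∣ agreement g true ∣) (∣ agreement g false ∣) ⟨
    2 * (∣ agreement g true ∣ + ∣ agreement g false ∣)    ≤⟨ *-monoʳ-≤ 2 (disjoint⇒∣p∣+∣q∣≤n (agreement g true) (agreement g false) disjoint) ⟩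
    2 * n                                                 ≡⟨ cong (n +_) (+-identityʳ n) ⟩
    n + n                                                 <⟨ +-monoˡ-< n n< ⟩
    2 * ∣ agreement g true ∣ + n                          ∎))
    where
    open ≤-Reasoning
    disjoint : ∀ {x} → x ∈ agreement g true → x ∉ agreement g false
    disjoint x∈t x∈f =
      let _ , _ , eq-t = ∈-comprehension⁻ (agreement? g true) x∈t
          _ , _ , eq-f = ∈-comprehension⁻ (agreement? g false) x∈f
      in Bool.not-¬ eq-f eq-t

  -- The sign character.

  χ : Fin n → Bool
  χ g = proj₁ (majority g)

  exceptional : Fin n → Subset n
  exceptional g = ∁ (agreement g (χ g))

  ∉-exceptional : ∀ g {x} → x ∉ exceptional g → Agreement g (χ g) x
  ∉-exceptional g x∉ = ∈-comprehension⁻ (agreement? g (χ g)) (x∉∁p⇒x∈p x∉)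

  -- A point of `A` sent into `A` obeys one of the two signs, so an exceptional one is in the
  -- minority set. That set has at most `n / 2` points and boundary at most `2 |D|`, so expansion
  -- makes it small.
  exceptional-sparse : ∀ g → Sparse (exceptional g)
  exceptional-sparse g = sparse (union-bound (∣ exceptional g ∣) (∣ ∁ A ∣) (∣ minority ∣) exceptional≤ ∁A-bound minority-bound)
    where
    open ≤-Reasoning
    union-bound : ∀ k a b → k ≤ a + (a + b) → 200 * a ≤ 3 * n → 200 * b ≤ 2 * n → 25 * k ≤ n
    union-bound k a b k≤ a≤ b≤ = *-cancelˡ-≤ 8 (begin
      8 * (25 * k)                           ≡⟨ *-assoc 8 25 k ⟨
      200 * k                                ≤⟨ *-monoʳ-≤ 200 k≤ ⟩
      200 * (a + (a + b))                    ≡⟨ distrib a b ⟩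
      200 * a + (200 * a + 200 * b)          ≤⟨ +-mono-≤ a≤ (+-mono-≤ a≤ b≤) ⟩
      3 * n + (3 * n + 2 * n)                ≡⟨ total n ⟩
      8 * n                                  ∎)
      where
      distrib : ∀ a b → 200 * (a + (a + b)) ≡ 200 * a + (200 * a + 200 * b)
      distrib = solve-∀
      total : ∀ a → 3 * a + (3 * a + 2 * a) ≡ 8 * a
      total = solve-∀
    minority : Subset n
    minority = agreement g (not (χ g))
    minority-bound : 200 * ∣ minority ∣ ≤ 2 * n
    minority-bound = ≤-trans
      (small-boundary⇒small 2 minority (proj₂ (majority g)) (∂agreement-bound g (not (χ g))))
      (*-monoʳ-≤ 2 (∣p∣≤n A))
    ⊆∪ : exceptional g ⊆ ∁ A ∪ (preimage (g ·_) (∁ A) ∪ minority)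
    ⊆∪ {x} x∈ with x ∈? A | (g · x) ∈? A
    ... | no x∉A  | _        = x∈p∪q⁺ (inj₁ (x∉p⇒x∈∁p x∉A))
    ... | yes _   | no gx∉A  = x∈p∪q⁺ (inj₂ (x∈p∪q⁺ (inj₁ (∈-preimage⁺ (g ·_) (x∉p⇒x∈∁p gx∉A)))))
    ... | yes x∈A | yes gx∈A = x∈p∪q⁺ (inj₂ (x∈p∪q⁺ (inj₂
      (∈-comprehension⁺ (agreement? g (not (χ g)))
        (x∈A , gx∈A , trans (Bool.¬-not neq) (Bool.not-distribˡ-xor (χ g) (c x)))))))
      where
      neq : c (g · x) ≢ χ g xor c x
      neq eq = x∈∁p⇒x∉p x∈ (∈-comprehension⁺ (agreement? g (χ g)) (x∈A , gx∈A , eq))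
    exceptional≤ : ∣ exceptional g ∣ ≤ ∣ ∁ A ∣ + (∣ ∁ A ∣ + ∣ minority ∣)
    exceptional≤ = begin
      ∣ exceptional g ∣                                      ≤⟨ p⊆q⇒∣p∣≤∣q∣ ⊆∪ ⟩
      ∣ ∁ A ∪ (preimage (g ·_) (∁ A) ∪ minority) ∣           ≤⟨ ∣p∪q∣≤∣p∣+∣q∣ (∁ A) _ ⟩
      ∣ ∁ A ∣ + ∣ preimage (g ·_) (∁ A) ∪ minority ∣         ≤⟨ +-monoʳ-≤ (∣ ∁ A ∣) (∣p∪q∣≤∣p∣+∣q∣ (preimage (g ·_) (∁ A)) minority) ⟩
      ∣ ∁ A ∣ + (∣ preimage (g ·_) (∁ A) ∣ + ∣ minority ∣)   ≡⟨ cong (λ k → ∣ ∁ A ∣ + (k + ∣ minority ∣)) (∣preimage∣≡∣p∣ (left g) (∁ A)) ⟩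
      ∣ ∁ A ∣ + (∣ ∁ A ∣ + ∣ minority ∣)                     ∎

  D-sparse : Sparse D
  D-sparse = sparse $ *-cancelˡ-≤ 8 (begin
    8 * (25 * ∣ D ∣)  ≡⟨ *-assoc 8 25 (∣ D ∣) ⟨
    200 * ∣ D ∣       ≤⟨ D-bound ⟩
    2 * n             ≤⟨ *-monoˡ-≤ n {2} {8} (s≤s (s≤s z≤n)) ⟩
    8 * n             ∎)
    where open ≤-Reasoning

  preimage-sparse : ∀ (π : Permutation′ n) {B} → Sparse B → Sparse (preimage (π ⟨$⟩ʳ_) B)
  preimage-sparse π {B} (sparse bound) =
    sparse (subst (λ k → 25 * k ≤ n) (sym (∣preimage∣≡∣p∣ π B)) bound)

  -- At a point `x` typical for `h` and `g · h`, with `h · x` typical for `g`, the side of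
  -- `g · h · x` is computed in two ways.
  χ-homo : ∀ g h → χ (g · h) ≡ χ g xor χ h
  χ-homo g h =
    let x , x∉h , hx∉g , x∉gh = sparse-union-avoidable
          (exceptional h) (preimage (h ·_) (exceptional g)) (exceptional (g · h))
          (exceptional-sparse h) (preimage-sparse (left h) (exceptional-sparse g)) (exceptional-sparse (g · h))
        _ , _ , at-h  = ∉-exceptional h x∉h
        _ , _ , at-g  = ∉-exceptional g (hx∉g ∘ ∈-preimage⁺ (h ·_))
        _ , _ , at-gh = ∉-exceptional (g · h) x∉gh
    in xor-cancelʳ (χ (g · h)) (χ g xor χ h) (c x) (begin
      χ (g · h) xor c x      ≡⟨ at-gh ⟨
      c ((g · h) · x)        ≡⟨ cong c (assoc g h x) ⟩
      c (g · (h · x))        ≡⟨ at-g ⟩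
      χ g xor c (h · x)      ≡⟨ cong (χ g xor_) at-h ⟩
      χ g xor (χ h xor c x)  ≡⟨ Bool.xor-assoc (χ g) (χ h) (c x) ⟨
      (χ g xor χ h) xor c x  ∎)
    where open ≡-Reasoning

  -- The exact 2-colouring.

  module _ (x₀ : Fin n) (x₀-sparse : Sparse ((exceptional ᵀ) x₀)) where

    -- `y · inv x₀` carries `x₀` to `y`, so its sign predicts the side of `y` relative to that of
    -- `x₀`.
    colour : Fin n → Bool
    colour y = χ (y · inv x₀)

    atypical : Fin n → Subset n
    atypical y = preimage (_· (y · inv x₀)) ((exceptional ᵀ) x₀)

    -- `t · (y · inv x₀)` sends `x₀` to `t · y`, and `χ-homo` splits its sign into that of `t` and
    -- the colour of `y`.
    colour-typical : ∀ t y → t ∉ atypical y → (t · y) ∈ A × c (t · y) ≡ (χ t xor colour y) xor c x₀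
    colour-typical t y t∉ =
      let _ , ∈A , eq = ∉-exceptional (t · (y · inv x₀)) (t∉ ∘ ∈-preimage⁺ (_· (y · inv x₀)) ∘ ∈-ᵀ⁺ exceptional)
      in subst (_∈ A) back ∈A ,
         trans (cong c (sym back)) (trans eq (cong (_xor c x₀) (χ-homo t (y · inv x₀))))
      where
      back : (t · (y · inv x₀)) · x₀ ≡ t · y
      back = trans (assoc t _ x₀) (cong (t ·_) (//-rightDividesˡ x₀ y))

    -- Some `t` moves the edge to a place where the colours determine the sides of both ends and
    -- `t · y ∉ D`. Equal colours would give equal sides there, but `alternates` makes them
    -- opposite.
    colour-proper : ∀ {y z} → y ~ z → colour y ≢ colour z
    colour-proper {y} {z} y~z same =
      let t , y-typical , z-typical , ty∉D = sparse-union-avoidable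
            (atypical y) (atypical z) (preimage (_· y) D)
            (preimage-sparse (right (y · inv x₀)) x₀-sparse)
            (preimage-sparse (right (z · inv x₀)) x₀-sparse)
            (preimage-sparse (right y) D-sparse)
          _    , cty = colour-typical t y y-typical
          tz∈A , ctz = colour-typical t z z-typical
          _    , flip = alternates (translate t y~z) tz∈A (ty∉D ∘ ∈-preimage⁺ (_· y))
      in Bool.not-¬ (trans cty (trans (cong (λ b → (χ t xor b) xor c x₀) same) (sym ctz))) flip

  bipartite : Bipartite G
  bipartite =
    let x₀ , x₀-sparse = average exceptional exceptional-sparse
    in colour x₀ x₀-sparse , colour-proper x₀ x₀-sparse

-- Fractions, and the bound 2 on vertex expansion.

/-cancel-≤ : ∀ a b q m .{{_ : NonZero q}} .{{_ : NonZero m}} →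
             (ℤ.+ a ℚ./ q) ℚ.≤ (ℤ.+ b ℚ./ m) → a * m ≤ b * q
/-cancel-≤ a b (suc q) (suc m) le
  -- `ℚ` reduces its fractions; unnormalised rationals are compared by cross-multiplication. `mkℚᵘ`
  -- stores the denominator minus one.
  with ℚᵘ.*≤* le′ ← ℚᵘ.≤-respʳ-≃ (ℚ.toℚᵘ-fromℚᵘ (ℚᵘ.mkℚᵘ (ℤ.+ b) m))
                      (ℚᵘ.≤-respˡ-≃ (ℚ.toℚᵘ-fromℚᵘ (ℚᵘ.mkℚᵘ (ℤ.+ a) q)) (ℚ.toℚᵘ-mono-≤ le))
  = ℤ.drop‿+≤+ (subst₂ ℤ._≤_ (sym (ℤ.pos-* a (suc m))) (sym (ℤ.pos-* b (suc q))) le′)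

/-mono-≤-scaled : ∀ k a b q m .{{_ : NonZero q}} .{{_ : NonZero m}} →
                  a * m ≤ k * (b * q) → (ℤ.+ a ℚ./ q) ℚ.≤ (ℤ.+ k ℚ./ 1) ℚ.* (ℤ.+ b ℚ./ m)
/-mono-≤-scaled k a b (suc q) (suc m) le = ℚ.toℚᵘ-cancel-≤ (begin
  ℚ.toℚᵘ (ℤ.+ a ℚ./ suc q)
    ≃⟨ ℚ.toℚᵘ-fromℚᵘ (ℚᵘ.mkℚᵘ (ℤ.+ a) q) ⟩
  ℚᵘ.mkℚᵘ (ℤ.+ a) q
    ≤⟨ ℚᵘ.*≤* a≤kb ⟩
  ℚᵘ.mkℚᵘ (ℤ.+ k) 0 ℚᵘ.* ℚᵘ.mkℚᵘ (ℤ.+ b) m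
    ≃⟨ ℚᵘ.*-cong (ℚ.toℚᵘ-fromℚᵘ (ℚᵘ.mkℚᵘ (ℤ.+ k) 0)) (ℚ.toℚᵘ-fromℚᵘ (ℚᵘ.mkℚᵘ (ℤ.+ b) m)) ⟨
  ℚ.toℚᵘ (ℤ.+ k ℚ./ 1) ℚᵘ.* ℚ.toℚᵘ (ℤ.+ b ℚ./ suc m)
    ≃⟨ ℚ.toℚᵘ-homo-* (ℤ.+ k ℚ./ 1) (ℤ.+ b ℚ./ suc m) ⟨
  ℚ.toℚᵘ ((ℤ.+ k ℚ./ 1) ℚ.* (ℤ.+ b ℚ./ suc m))
    ∎)
  where
  open ℚᵘ.≤-Reasoning
  -- The denominator `1 * suc m` of the product unfolds to `suc (m + 0)`.
  a≤kb : ℤ.+ a ℤ.* ℤ.+ suc (m + 0) ℤ.≤ (ℤ.+ k ℤ.* ℤ.+ b) ℤ.* ℤ.+ suc q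
  a≤kb = subst₂ ℤ._≤_
    (trans (cong (λ m → ℤ.+ (a * suc m)) (sym (+-identityʳ m))) (ℤ.pos-* a (suc (m + 0))))
    (trans (cong ℤ.+_ (sym (*-assoc k b (suc q))))
      (trans (ℤ.pos-* (k * b) (suc q)) (cong (ℤ._* ℤ.+ suc q) (ℤ.pos-* k b))))
    (ℤ.+≤+ le)

-- Any set of `⌊ n /2⌋` vertices serves as a test: its boundary lies in the complement, of size
-- `⌈ n /2⌉`, which is at most `2 * ⌊ n /2⌋` once `n ≥ 2`.
expansion≤2 : (G : Graph n) (p q : ℕ) → 2 ≤ n →
              (∀ B → 0 < ∣ B ∣ → 2 * ∣ B ∣ ≤ n → p * ∣ B ∣ ≤ ∣ ∂out G B ∣ * q) →
              p ≤ 2 * q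
expansion≤2 {n@(suc (suc n′))} G p q (s≤s (s≤s _)) expanding
  with B , ∣B∣≡ ← subset-of-size (⌊n/2⌋≤n n) = *-cancelʳ-≤ p (2 * q) (suc ⌊ n′ /2⌋) (begin
    p * ⌊ n /2⌋              ≡⟨ cong (p *_) ∣B∣≡ ⟨
    p * ∣ B ∣                ≤⟨ expanding B (subst (0 <_) (sym ∣B∣≡) z<s) 2B≤n ⟩
    ∣ ∂out G B ∣ * q         ≤⟨ *-monoˡ-≤ q ∂B≤ ⟩
    2 * ⌊ n /2⌋ * q          ≡⟨ swap (⌊ n /2⌋) q ⟩
    2 * q * ⌊ n /2⌋          ∎)
  where
  open ≤-Reasoning
  swap : ∀ a b → 2 * a * b ≡ 2 * b * a
  swap = solve-∀
  ⌈n/2⌉≤ : ⌈ n /2⌉ ≤ suc ⌊ n /2⌋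
  -- The two sides unfold to `⌊ suc n /2⌋` and `⌊ suc (suc n) /2⌋`.
  ⌈n/2⌉≤ = ⌊n/2⌋-mono (n≤1+n (suc n))
  2B≤n : 2 * ∣ B ∣ ≤ n
  2B≤n = begin
    2 * ∣ B ∣                ≡⟨ cong (2 *_) ∣B∣≡ ⟩
    2 * ⌊ n /2⌋              ≡⟨ cong (λ k → ⌊ n /2⌋ + k) (+-identityʳ _) ⟩
    ⌊ n /2⌋ + ⌊ n /2⌋        ≤⟨ +-monoʳ-≤ ⌊ n /2⌋ (⌊n/2⌋≤⌈n/2⌉ n) ⟩
    ⌊ n /2⌋ + ⌈ n /2⌉        ≡⟨ ⌊n/2⌋+⌈n/2⌉≡n n ⟩
    n                        ∎
  ∂B≤ : ∣ ∂out G B ∣ ≤ 2 * ⌊ n /2⌋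
  ∂B≤ = +-cancelˡ-≤ ⌊ n /2⌋ _ _ (begin
    ⌊ n /2⌋ + ∣ ∂out G B ∣      ≡⟨ cong (_+ ∣ ∂out G B ∣) ∣B∣≡ ⟨
    ∣ B ∣ + ∣ ∂out G B ∣        ≤⟨ disjoint⇒∣p∣+∣q∣≤n B (∂out G B) (λ x∈B x∈∂ → proj₁ (∈-∂out⁻ G B x∈∂) x∈B) ⟩
    n                           ≡⟨ ⌊n/2⌋+⌈n/2⌉≡n n ⟨
    ⌊ n /2⌋ + ⌈ n /2⌉           ≤⟨ +-monoʳ-≤ ⌊ n /2⌋ (≤-trans ⌈n/2⌉≤ (+-monoˡ-≤ ⌊ n /2⌋ (s≤s z≤n))) ⟩
    ⌊ n /2⌋ + (⌊ n /2⌋ + ⌊ n /2⌋)  ≡⟨ cong (λ k → ⌊ n /2⌋ + (⌊ n /2⌋ + k)) (+-identityʳ _) ⟨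
    ⌊ n /2⌋ + 2 * ⌊ n /2⌋       ∎)

-- The defect set of a pair `L`, `R`.

module _ (G : Graph n) (L R : Subset n) where
  open Graph G

  -- This repeats the comprehension inside `I`, so that `I G B` is its size by definition.
  inner : Subset n → Subset n
  inner B = comprehension (λ x → (x ∈? B) ×-dec hasNeighbourIn? G B x)

  defect : Subset n
  defect = (inner L ∪ inner R) ∪ ∂out G (L ∪ R)

  ∣defect∣≤ : ∣ defect ∣ ≤ I G L + I G R + ∣ ∂out G (L ∪ R) ∣
  ∣defect∣≤ = ≤-trans (∣p∪q∣≤∣p∣+∣q∣ (inner L ∪ inner R) _) (+-monoˡ-≤ _ (∣p∪q∣≤∣p∣+∣q∣ (inner L) (inner R)))

  ∈-inner⁺ : ∀ B {x y} → x ∈ B → y ∈ B → x ~ y → x ∈ inner B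
  ∈-inner⁺ B x∈B y∈B x~y = ∈-comprehension⁺ (λ x → (x ∈? B) ×-dec hasNeighbourIn? G B x) (x∈B , _ , y∈B , x~y)

  -- Avoiding `∂out` keeps `x` in `L ∪ R`. Equal values of `lookup L` put both ends in `L` or both
  -- in `R`, making `x` an inner point.
  defect-alternates : ∀ {x y} → x ~ y → y ∈ L ∪ R → x ∉ defect →
                      x ∈ L ∪ R × lookup L x ≡ not (lookup L y)
  defect-alternates {x} {y} x~y y∈ x∉ = x∈ , Bool.¬-not same-side
    where
    x∈ : x ∈ L ∪ R
    x∈ = decidable-stable (x ∈? L ∪ R) λ x∉L∪R → x∉ (x∈p∪q⁺ (inj₂
      (∈-comprehension⁺ (λ x → ¬? (x ∈? L ∪ R) ×-dec hasNeighbourIn? G (L ∪ R) x) (x∉L∪R , y , y∈ , x~y))))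
    same-side : lookup L x ≢ lookup L y
    same-side eq with x∈p∪q⁻ L R x∈ | x∈p∪q⁻ L R y∈
    ... | inj₂ x∈R | inj₂ y∈R = x∉ (x∈p∪q⁺ (inj₁ (x∈p∪q⁺ (inj₂ (∈-inner⁺ R x∈R y∈R x~y)))))
    ... | inj₁ x∈L | _        = x∉ (x∈p∪q⁺ (inj₁ (x∈p∪q⁺ (inj₁
      (∈-inner⁺ L x∈L (lookup⇒[]= y L (trans (sym eq) ([]=⇒lookup x∈L))) x~y)))))
    ... | inj₂ _   | inj₁ y∈L = x∉ (x∈p∪q⁺ (inj₁ (x∈p∪q⁺ (inj₁
      (∈-inner⁺ L (lookup⇒[]= x L (trans eq ([]=⇒lookup y∈L))) y∈L x~y)))))

-- Transport of the group to `Fin n`.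

module CayleyGroup (X : Group c ℓ) (enumeration : Inverse (Group.setoid X) (setoid (Fin n))) where
  open Group X using (_∙_; ε; _⁻¹; rawGroup)
  private module X = Group X
  open Inverse enumeration using (to; from; to-cong; strictlyInverseˡ; strictlyInverseʳ)
  open Cayley X enumeration using (_⁻¹ˢ; cayleyGraph)

  infixl 7 _·_
  _·_ : Fin n → Fin n → Fin n
  x · y = to (from x ∙ from y)

  -- `from` is an injective homomorphism into `X`, so the group laws pull back to `_≡_` on indices.
  ·-isGroup : IsGroup _≡_ _·_ (to ε) (λ x → to (from x ⁻¹))
  ·-isGroup = GroupMonomorphism.isGroup {G₁ = indexRawGroup} {G₂ = rawGroup} {⟦_⟧ = from} (record
    { isGroupHomomorphism = record
      { isMonoidHomomorphism = record
        { isMagmaHomomorphism = record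
          { isRelHomomorphism = record { cong = λ { refl → X.refl } }
          ; homo              = λ _ _ → strictlyInverseʳ _
          }
        ; ε-homo = strictlyInverseʳ _
        }
      ; ⁻¹-homo = λ _ → strictlyInverseʳ _
      }
    ; injective = λ {x} {y} eq → trans (sym (strictlyInverseˡ x)) (trans (to-cong eq) (strictlyInverseˡ y))
    }) X.isGroup
    where
    indexRawGroup : RawGroup _ _
    indexRawGroup = record { _≈_ = _≡_ ; _∙_ = _·_ ; ε = to ε ; _⁻¹ = λ x → to (from x ⁻¹) }

  -- Edges multiply by a generator on the right, so by associativity the same `s` serves after a
  -- left translation.
  ·-translate : (S : Subset n) (S⁻¹≡S : S ⁻¹ˢ ≡ S) → let open Graph (cayleyGraph S S⁻¹≡S) in
                ∀ t {x y} → x ~ y → (t · x) ~ (t · y)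
  ·-translate S _ t {x} (s , s∈S , refl) = s , s∈S , IsGroup.assoc ·-isGroup t x s

theorem3 : ∀ {c ℓ : Level} (X : Group c ℓ) (n : ℕ)
    (enumeration : Inverse (Group.setoid X) (setoid (Fin n))) →
    let open Cayley X enumeration in
    (S : Subset n) (d : ℕ) → ∣ S ∣ ≡ d → Generates S →
    (S⁻¹≡S : S ⁻¹ˢ ≡ S) →
    let G = cayleyGraph S S⁻¹≡S in
    ¬ Bipartite G →
    (h β : ℚ) → IsVertexExpansion G h → IsBipartitenessConstant G β →
    h ℚ.≤ (ℤ.+ 200 ℚ./ 1) ℚ.* β
theorem3 X n enumeration S d _ _ S⁻¹≡S ¬bipartite h β
  (expansionRatio A 0<A 2A≤n , minimal) (bipartitenessRatio L R _ L∪R≢∅ , _) =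
  /-mono-≤-scaled 200 (∣ ∂out G A ∣) k (∣ A ∣) (∣ L ∪ R ∣) {{>-nonZero 0<A}} {{>-nonZero (nonempty⇒0<∣∣ L∪R≢∅)}}
    -- `small` is `200 β < h` cleared of denominators, with `p = |∂out A|` and `q = |A|` read off
    -- the minimiser `A`.
    (≮⇒≥ λ small → ¬bipartite (Translates.bipartite G ·-isGroup (·-translate S S⁻¹≡S)
      (L ∪ R) (defect G L R) (lookup L) (defect-alternates G L R)
      -- `n ≥ 2` because `A` is nonempty and has at most `n / 2` points.
      (∣ ∂out G A ∣) (∣ A ∣) (expansion≤2 G _ _ (≤-trans (*-monoʳ-≤ 2 0<A) 2A≤n) expanding) expanding
      (≤-<-trans (*-monoʳ-≤ 200 (*-monoˡ-≤ (∣ A ∣) (∣defect∣≤ G L R))) small)))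
  where
  open CayleyGroup X enumeration
  G = Cayley.cayleyGraph X enumeration S S⁻¹≡S
  k = I G L + I G R + ∣ ∂out G (L ∪ R) ∣
  expanding : ∀ B → 0 < ∣ B ∣ → 2 * ∣ B ∣ ≤ n → ∣ ∂out G A ∣ * ∣ B ∣ ≤ ∣ ∂out G B ∣ * ∣ A ∣
  expanding B 0<B 2B≤n = /-cancel-≤ (∣ ∂out G A ∣) (∣ ∂out G B ∣) (∣ A ∣) (∣ B ∣)
    {{>-nonZero 0<A}} {{>-nonZero 0<B}} (minimal (expansionRatio B 0<B 2B≤n))
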